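{- Let $G$ be a graph, let $F(G)$ be the union of all tree components of $G$ and $cmp(F(G))$ the number of tree components of $G$, and let $k\ge1$. The following are equivalent: (a1) $M_k(G)$ has at least one circuit; (a2) $k\le \Delta G+cmp(F(G))$; (a3) $M_k(G)$ is a non-trivial matroid.
   Context: Graphs are finite, may have loops and parallel edges, and have no isolated vertices. $\Delta G=|E(G)|-|V(G)|$. For $X\subseteq E(G)$, $G\langle X\rangle$ is the subgraph with edge set $X$ and vertex set the vertices incident to $X$. For $k\ge0$, the $k$-circular matroid $M_k(G)$ is the matroid on $E(G)$ whose circuits are the inclusion-minimal members of $\{C\subseteq E(G):C\neq\emptyset,\ |C|=|V(G\langle C\rangle)|+k\}$. A matroid on $E$ is trivial if $E$ is a base or $E$ is a cobase (i.e. $E\setminus\emptyset$ complement of a base is $E$), and non-trivial otherwise; equivalently, non-trivial means it has at least one circuit and at least one cocircuit. -}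

module Defs where

open import Data.Fin.Base using (Fin)
open import Data.Fin.Properties using (any?; all?; injective⇒≤)
  renaming (_≟_ to _≟ᶠ_)
open import Data.Fin.Subset
  using (Subset; inside; outside; _∈_; _⊆_; _∪_; _∩_; _-_; ∁; ⊤; ∣_∣; Nonempty; ⁅_⁆)
open import Data.Fin.Subset.Properties
open import Data.Integer.Base using (ℤ; _⊖_)
open import Data.List.Base as List using (List; length)
import Data.List.Membership.Propositional as ListMem
open import Data.List.Membership.Propositional.Properties using (∈-lookup)
open import Data.List.Relation.Unary.All as All using ()
open import Data.List.Relation.Unary.AllPairs using ()
  renaming ([] to []ᵖ; _∷_ to _∷ᵖ_)
open import Data.List.Relation.Unary.Any as Any using (here; there)
open import Data.List.Relation.Unary.Unique.Propositional using (Unique)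
import Data.List.Relation.Unary.Unique.DecPropositional as DecUnique
open import Data.Nat.Base using (ℕ; zero; suc; _+_; _≤_; _<_; z≤n; s≤s)
open import Data.Nat.Induction using (<-wellFounded)
open import Data.Nat.Properties
  using (_≟_; ≤-reflexive; ≤-trans; ≤∧≢⇒<; ≤-pred; ≮⇒≥; n≤1+n; _<?_; _≤?_; +-suc;
         +-monoˡ-≤; +-monoʳ-<; +-mono-≤; +-cancelʳ-<; m≤m+n; suc-injective; anyUpTo?;
         module ≤-Reasoning)
open import Data.Nat.Solver using (module +-*-Solver)
open import Data.Product.Base using (_×_; _,_; proj₁; proj₂; ∃-syntax; Σ-syntax)
open import Data.Product.Properties using (≡-dec)
open import Data.Sum.Base using (_⊎_; inj₁; inj₂)
open import Data.Vec.Base using ([]; _∷_; tabulate)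
open import Data.Vec.Properties using (lookup∘tabulate; []=⇒lookup; lookup⇒[]=)
  renaming (≡-dec to ≡-decᵛ)
open import Data.Bool.Properties using () renaming (_≟_ to _≟ᵇ_)
open import Function.Base using (_∘_)
open import Induction.WellFounded using (Acc; acc)
open import Relation.Binary.Definitions using (DecidableEquality)
open import Relation.Binary.PropositionalEquality
  using (_≡_; _≢_; refl; sym; trans; cong; cong₂; subst)
open import Relation.Nullary using (¬_; Dec; yes; no; does; contradiction)
open import Relation.Nullary.Decidable
  using (_×-dec_; _⊎-dec_; _→-dec_; ¬?; map′; decidable-stable; dec-true)
open import Relation.Unary using (Decidable)

------------------------------------------------------------------------
-- Subsets

_≟ˢ_ : ∀ {n} → DecidableEquality (Subset n)
_≟ˢ_ = ≡-decᵛ _≟ᵇ_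

allSubset? : ∀ {n} {P : Subset n → Set} → Decidable P → Dec (∀ X → P X)
allSubset? P? = map′
  (λ ¬∃ X → decidable-stable (P? X) (λ ¬p → ¬∃ (X , ¬p)))
  (λ { f (X , ¬p) → ¬p (f X) })
  (¬? (anySubset? (¬? ∘ P?)))

-- Every subset of Fin n, each exactly once.
subsets : ∀ n → List (Subset n)
subsets zero    = [] List.∷ List.[]
subsets (suc n) = List.map (outside ∷_) (subsets n) List.++ List.map (inside ∷_) (subsets n)

IsMinimal : ∀ {n} → (Subset n → Set) → Subset n → Set
IsMinimal P C = P C × (∀ D → P D → D ⊆ C → D ≡ C)

------------------------------------------------------------------------
-- Matroids on Fin n, presented by their circuits

record Matroid (n : ℕ) : Set₁ where
  field
    IsCircuit   : Subset n → Set
    nonempty    : ∀ {C} → IsCircuit C → Nonempty C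
    antichain   : ∀ {C D} → IsCircuit C → IsCircuit D → C ⊆ D → C ≡ D
    elimination : ∀ {C D e} → IsCircuit C → IsCircuit D → C ≢ D → e ∈ C → e ∈ D →
                  ∃[ F ] (IsCircuit F × F ⊆ (C ∪ D) - e)

  Independent : Subset n → Set
  Independent I = ∀ C → IsCircuit C → ¬ (C ⊆ I)

  IsBase : Subset n → Set
  IsBase B = Independent B × (∀ I → Independent I → B ⊆ I → B ≡ I)

  IsCobase : Subset n → Set
  IsCobase B = IsBase (∁ B)

  Trivial : Set
  Trivial = IsBase ⊤ ⊎ IsCobase ⊤

  NonTrivial : Set
  NonTrivial = ¬ Trivial

------------------------------------------------------------------------
-- Graphs

-- The order of the two ends of an edge carries no meaning: everything below
-- uses them only through Incident and Joins, which are symmetric.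
record Graph : Set where
  field
    #V #E : ℕ
    ends  : Fin #E → Fin #V × Fin #V

  Vertex : Set
  Vertex = Fin #V

  Edge : Set
  Edge = Fin #E

  Incident : Edge → Vertex → Set
  Incident e v = proj₁ (ends e) ≡ v ⊎ proj₂ (ends e) ≡ v

  field
    noIsolated : ∀ v → ∃[ e ] Incident e v

  Joins : Edge → Vertex → Vertex → Set
  Joins e u v = ends e ≡ (u , v) ⊎ ends e ≡ (v , u)

  incident? : ∀ e v → Dec (Incident e v)
  incident? e v = (proj₁ (ends e) ≟ᶠ v) ⊎-dec (proj₂ (ends e) ≟ᶠ v)

  joins? : ∀ e u v → Dec (Joins e u v)
  joins? e u v = ≡-dec _≟ᶠ_ _≟ᶠ_ (ends e) (u , v) ⊎-dec ≡-dec _≟ᶠ_ _≟ᶠ_ (ends e) (v , u)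

  covered? : ∀ X v → Dec (∃[ e ] (e ∈ X × Incident e v))
  covered? X v = any? (λ e → (e ∈? X) ×-dec incident? e v)

  -- The vertex set of G⟨ X ⟩.
  V⟨_⟩ : Subset #E → Subset #V
  V⟨ X ⟩ = tabulate (λ v → does (covered? X v))

  Δ : ℤ
  Δ = #E ⊖ #V

module _ (G : Graph) where
  open Graph G

  ----------------------------------------------------------------------
  -- Tree components

  -- Walks of G⟨ X ⟩.
  data Walk (X : Subset #E) : Vertex → Vertex → Set where
    nil  : ∀ {v} → Walk X v v
    step : ∀ {u v w} e → e ∈ X → Joins e u v → Walk X v w → Walk X u w

  -- All vertices of the walk but the last, in order.
  sources : ∀ {X u v} → Walk X u v → List Vertex
  sources nil                    = List.[]
  sources (step {u = u} _ _ _ w) = u List.∷ sources w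

  edges : ∀ {X u v} → Walk X u v → List Edge
  edges nil            = List.[]
  edges (step e _ _ w) = e List.∷ edges w

  Connected : Subset #E → Set
  Connected X = ∀ u v → u ∈ V⟨ X ⟩ → v ∈ V⟨ X ⟩ → Walk X u v

  -- Distinctness of the edges rules out traversing a single link back and
  -- forth; loops and pairs of parallel links are cycles.
  IsCycle : ∀ {X v} → Walk X v v → Set
  IsCycle w = 1 ≤ length (edges w) × Unique (sources w) × Unique (edges w)

  Acyclic : Subset #E → Set
  Acyclic X = ∀ v (w : Walk X v v) → ¬ IsCycle w

  IsTree : Subset #E → Set
  IsTree X = Connected X × Acyclic X

  -- As G has no isolated vertices, its components (maximal connected
  -- subgraphs) are of the form G⟨ X ⟩ with X nonempty.
  IsComponent : Subset #E → Set
  IsComponent X =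
    Nonempty X × Connected X × (∀ Y → X ⊆ Y → Connected Y → Y ≡ X)

  IsTreeComponent : Subset #E → Set
  IsTreeComponent X = IsComponent X × IsTree X

  lookup-inj : ∀ {A : Set} {xs : List A} → Unique xs →
               ∀ i j → List.lookup xs i ≡ List.lookup xs j → i ≡ j
  lookup-inj (_ ∷ᵖ _) Fin.zero Fin.zero _ = refl
  lookup-inj {xs = _ List.∷ xs} (x∉ ∷ᵖ _) Fin.zero (Fin.suc j) eq =
    contradiction eq (All.lookup x∉ (∈-lookup {xs = xs} j))
  lookup-inj {xs = _ List.∷ xs} (x∉ ∷ᵖ _) (Fin.suc i) Fin.zero eq =
    contradiction (sym eq) (All.lookup x∉ (∈-lookup {xs = xs} i))
  lookup-inj (_ ∷ᵖ u) (Fin.suc i) (Fin.suc j) eq = cong Fin.suc (lookup-inj u i j eq)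

  unique⇒length≤ : ∀ {n} {xs : List (Fin n)} → Unique xs → length xs ≤ n
  unique⇒length≤ u = injective⇒≤ (λ {i} {j} → lookup-inj u i j)

  length-edges : ∀ {X u v} (w : Walk X u v) → length (edges w) ≡ length (sources w)
  length-edges nil            = refl
  length-edges (step _ _ _ w) = cong suc (length-edges w)

  walk? : ∀ X n u v {P : List Vertex → List Edge → Set} → (∀ vs es → Dec (P vs es)) →
          Dec (Σ[ w ∈ Walk X u v ] (length (edges w) ≡ n × P (sources w) (edges w)))
  walk? X zero u v P? with u ≟ᶠ v | P? List.[] List.[]
  ... | yes refl | yes p = yes (nil , refl , p)
  ... | yes refl | no ¬p = no λ { (nil , _ , p) → ¬p p }
  ... | no u≢v   | _     = no λ { (nil , _ , _) → u≢v refl }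
  walk? X (suc n) u v P? = map′
    (λ { (e , x , e∈X , j , w , l , p) → step e e∈X j w , cong suc l , p })
    (λ { (step {v = x} e e∈X j w , l , p) → e , x , e∈X , j , w , suc-injective l , p })
    (any? λ e → any? λ x → (e ∈? X) ×-dec joins? e u x ×-dec
      walk? X n x v (λ vs es → P? (u List.∷ vs) (e List.∷ es)))

  uniqueWalk? : ∀ X u v {P : List Vertex → List Edge → Set} → (∀ vs es → Dec (P vs es)) →
                Dec (Σ[ w ∈ Walk X u v ] (Unique (sources w) × P (sources w) (edges w)))
  uniqueWalk? X u v P? = map′
    (λ { (_ , _ , w , _ , q) → w , q })
    (λ { (w , q) → length (edges w) ,
           s≤s (≤-trans (≤-reflexive (length-edges w)) (unique⇒length≤ (proj₁ q))) ,
           w , refl , q })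
    (anyUpTo? (λ n → walk? X n u v (λ vs es → unique? vs ×-dec P? vs es)) (suc #V))
    where open DecUnique (_≟ᶠ_ {#V}) using (unique?)

  dropTo : ∀ {X u v x} (w : Walk X u v) → Unique (sources w) → x ListMem.∈ sources w →
           Σ[ p ∈ Walk X x v ] Unique (sources p)
  dropTo w@(step _ _ _ _) u (here refl) = w , u
  dropTo (step _ _ _ w) (_ ∷ᵖ u) (there x∈) = dropTo w u x∈

  shorten : ∀ {X u v} → Walk X u v → Σ[ p ∈ Walk X u v ] Unique (sources p)
  shorten nil = nil , []ᵖ
  shorten (step {u = u} e e∈X j w) with shorten w
  ... | p , q with Any.any? (u ≟ᶠ_) (sources p)
  ...   | yes u∈ = dropTo p q u∈
  ...   | no  u∉ = step e e∈X j p , All.tabulate (λ { x∈ refl → u∉ x∈ }) ∷ᵖ q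

  connected? : Decidable Connected
  connected? X = all? λ u → all? λ v → (u ∈? V⟨ X ⟩) →-dec ((v ∈? V⟨ X ⟩) →-dec
    map′ proj₁ (λ w → let (p , q) = shorten w in p , q , z≤n)
         (uniqueWalk? X u v (λ _ _ → 0 ≤? 0)))

  acyclic? : Decidable Acyclic
  acyclic? X = all? λ v → map′
    (λ { ¬∃ w (l , s , e) → ¬∃ (w , s , l , e) })
    (λ { f (w , s , l , e) → f w (l , s , e) })
    (¬? (uniqueWalk? X v v (λ _ es → (1 ≤? length es) ×-dec unique? es)))
    where open DecUnique (_≟ᶠ_ {#E}) using (unique?)

  isComponent? : Decidable IsComponent
  isComponent? X = nonempty? X ×-dec connected? X ×-dec
    allSubset? (λ Y → (X ⊆? Y) →-dec (connected? Y →-dec (Y ≟ˢ X)))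

  isTreeComponent? : Decidable IsTreeComponent
  isTreeComponent? X = isComponent? X ×-dec connected? X ×-dec acyclic? X

  treeComponents : List (Subset #E)
  treeComponents = List.filter isTreeComponent? (subsets #E)

  -- cmp(F(G)), where F(G) is the union of the tree components of G.
  cmpF : ℕ
  cmpF = length treeComponents

  ----------------------------------------------------------------------
  -- The k-circular matroid

  KTight : ℕ → Subset #E → Set
  KTight k C = Nonempty C × ∣ C ∣ ≡ ∣ V⟨ C ⟩ ∣ + k

  IsKCircuit : ℕ → Subset #E → Set
  IsKCircuit k = IsMinimal (KTight k)

  kTight? : ∀ k → Decidable (KTight k)
  kTight? k C = nonempty? C ×-dec (∣ C ∣ ≟ ∣ V⟨ C ⟩ ∣ + k)

  isKCircuit? : ∀ k → Decidable (IsKCircuit k)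
  isKCircuit? k C = kTight? k C ×-dec
    allSubset? (λ D → kTight? k D →-dec ((D ⊆? C) →-dec (D ≟ˢ C)))

module KCircularProof (G : Graph) (k : ℕ) where
  open Graph G

  ∈V⁻ : ∀ {X v} → v ∈ V⟨ X ⟩ → ∃[ e ] (e ∈ X × Incident e v)
  ∈V⁻ {X} {v} v∈ with covered? X v | trans (sym (lookup∘tabulate (λ v → does (covered? X v)) v)) ([]=⇒lookup v∈)
  ... | yes p | _ = p
  ... | no  _ | ()

  ∈V⁺ : ∀ {X v e} → e ∈ X → Incident e v → v ∈ V⟨ X ⟩
  ∈V⁺ {X} {v} {e} e∈X i = lookup⇒[]= v V⟨ X ⟩
    (trans (lookup∘tabulate (λ v → does (covered? X v)) v) (dec-true (covered? X v) (e , e∈X , i)))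

  V-mono : ∀ {X Y} → X ⊆ Y → V⟨ X ⟩ ⊆ V⟨ Y ⟩
  V-mono X⊆Y v∈ = let (_ , e∈X , i) = ∈V⁻ v∈ in ∈V⁺ (X⊆Y e∈X) i

  ∣V∣-mono : ∀ {X Y} → X ⊆ Y → ∣ V⟨ X ⟩ ∣ ≤ ∣ V⟨ Y ⟩ ∣
  ∣V∣-mono X⊆Y = p⊆q⇒∣p∣≤∣q∣ (V-mono X⊆Y)

  ∣p∣+∣q∣ : ∀ {n} (p q : Subset n) → ∣ p ∣ + ∣ q ∣ ≡ ∣ p ∪ q ∣ + ∣ p ∩ q ∣
  ∣p∣+∣q∣ [] [] = refl
  ∣p∣+∣q∣ (outside ∷ p) (outside ∷ q) = ∣p∣+∣q∣ p q
  ∣p∣+∣q∣ (inside ∷ p) (outside ∷ q) = cong suc (∣p∣+∣q∣ p q)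
  ∣p∣+∣q∣ (outside ∷ p) (inside ∷ q) = trans (+-suc ∣ p ∣ ∣ q ∣) (cong suc (∣p∣+∣q∣ p q))
  ∣p∣+∣q∣ (inside ∷ p) (inside ∷ q) = cong suc
    (trans (+-suc ∣ p ∣ ∣ q ∣) (trans (cong suc (∣p∣+∣q∣ p q)) (sym (+-suc ∣ p ∪ q ∣ ∣ p ∩ q ∣))))

  ∣p∣≤suc : ∀ {n} (p : Subset n) x → ∣ p ∣ ≤ suc ∣ p - x ∣
  ∣p∣≤suc (outside ∷ p) Fin.zero = ≤-trans (≤-reflexive (cong ∣_∣ (sym (p─⊥≡p p)))) (n≤1+n _)
  ∣p∣≤suc (inside ∷ p) Fin.zero = s≤s (≤-reflexive (cong ∣_∣ (sym (p─⊥≡p p))))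
  ∣p∣≤suc (outside ∷ p) (Fin.suc x) = ∣p∣≤suc p x
  ∣p∣≤suc (inside ∷ p) (Fin.suc x) = s≤s (∣p∣≤suc p x)

  ∣p∣>0⇒nonempty : ∀ {n} (p : Subset n) → 1 ≤ ∣ p ∣ → Nonempty p
  ∣p∣>0⇒nonempty {n} p 1≤ with nonempty? p
  ... | yes ne = ne
  ... | no ¬ne with refl ← Empty-unique ¬ne with () ← subst (1 ≤_) (∣⊥∣≡0 n) 1≤

  nonempty⇒∣p∣>0 : ∀ {n} {p : Subset n} → Nonempty p → 1 ≤ ∣ p ∣
  nonempty⇒∣p∣>0 {p = p} (x , x∈p) = ≤-trans (s≤s z≤n) (x∈p⇒∣p-x∣<∣p∣ x∈p)

  ∣V∣>0 : ∀ {X} → Nonempty X → 1 ≤ ∣ V⟨ X ⟩ ∣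
  ∣V∣>0 (e , e∈X) = nonempty⇒∣p∣>0 (_ , ∈V⁺ e∈X (inj₁ refl))

  dense-minus : ∀ {X e} → e ∈ X → ∣ V⟨ X ⟩ ∣ + k < ∣ X ∣ →
                Nonempty (X - e) × ∣ V⟨ X - e ⟩ ∣ + k ≤ ∣ X - e ∣
  dense-minus {X} {e} e∈X lt =
    ∣p∣>0⇒nonempty _ (≤-trans (≤-trans (∣V∣>0 (e , e∈X)) (m≤m+n _ k)) le) ,
    ≤-trans (+-monoˡ-≤ k (∣V∣-mono (p─q⊆p X ⁅ e ⁆))) le
    where
    le : ∣ V⟨ X ⟩ ∣ + k ≤ ∣ X - e ∣
    le = ≤-pred (≤-trans lt (∣p∣≤suc X e))

  dense⇒tight : ∀ {X} → Acc _<_ ∣ X ∣ → Nonempty X → ∣ V⟨ X ⟩ ∣ + k ≤ ∣ X ∣ →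
                ∃[ C ] (KTight G k C × C ⊆ X)
  dense⇒tight {X} (acc rs) ne le with ∣ X ∣ ≟ ∣ V⟨ X ⟩ ∣ + k
  ... | yes eq = X , (ne , eq) , ⊆-refl
  ... | no neq =
    let (e , e∈X)       = ne
        (ne′ , le′)     = dense-minus e∈X (≤∧≢⇒< le (neq ∘ sym))
        (C , t , C⊆X-e) = dense⇒tight (rs (x∈p⇒∣p-x∣<∣p∣ e∈X)) ne′ le′
    in C , t , p─q⊆p X ⁅ e ⁆ ∘ C⊆X-e

  ⊆∧≢⇒∣∣< : ∀ {n} {p q : Subset n} → p ⊆ q → p ≢ q → ∣ p ∣ < ∣ q ∣
  ⊆∧≢⇒∣∣< {p = p} {q} p⊆q p≢q with any? (λ x → (x ∈? q) ×-dec ¬? (x ∈? p))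
  ... | yes w = p⊂q⇒∣p∣<∣q∣ (p⊆q , w)
  ... | no ¬w = contradiction
    (⊆-antisym p⊆q (λ {x} x∈q → decidable-stable (x ∈? p) (λ x∉p → ¬w (x , x∈q , x∉p)))) p≢q

  tight⇒circuit : ∀ {X} → Acc _<_ ∣ X ∣ → KTight G k X → ∃[ C ] (IsKCircuit G k C × C ⊆ X)
  tight⇒circuit {X} (acc rs) t
    with anySubset? (λ D → kTight? G k D ×-dec (D ⊆? X) ×-dec ¬? (D ≟ˢ X))
  ... | yes (D , tD , D⊆X , D≢X) =
    let (C , c , C⊆D) = tight⇒circuit (rs (⊆∧≢⇒∣∣< D⊆X D≢X)) tD in C , c , D⊆X ∘ C⊆D
  ... | no ¬w = X , (t , λ D tD D⊆X →
    decidable-stable (D ≟ˢ X) (λ D≢X → ¬w (D , tD , D⊆X , D≢X))) , ⊆-refl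

  dense⇒circuit : ∀ {X} → Nonempty X → ∣ V⟨ X ⟩ ∣ + k ≤ ∣ X ∣ → ∃[ C ] (IsKCircuit G k C × C ⊆ X)
  dense⇒circuit ne le =
    let (_ , t , D⊆X) = dense⇒tight (<-wellFounded _) ne le
        (C , c , C⊆D) = tight⇒circuit (<-wellFounded _) t
    in C , c , D⊆X ∘ C⊆D

  V-∪ : ∀ X Y → V⟨ X ∪ Y ⟩ ⊆ V⟨ X ⟩ ∪ V⟨ Y ⟩
  V-∪ X Y v∈ with ∈V⁻ v∈
  ... | _ , e∈ , i with x∈p∪q⁻ X Y e∈
  ...   | inj₁ e∈X = x∈p∪q⁺ (inj₁ (∈V⁺ e∈X i))
  ...   | inj₂ e∈Y = x∈p∪q⁺ (inj₂ (∈V⁺ e∈Y i))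

  V-∩ : ∀ X Y → V⟨ X ∩ Y ⟩ ⊆ V⟨ X ⟩ ∩ V⟨ Y ⟩
  V-∩ X Y v∈ = x∈p∩q⁺ (V-mono (p∩q⊆p X Y) v∈ , V-mono (p∩q⊆q X Y) v∈)

  antichain : ∀ {C D} → IsKCircuit G k C → IsKCircuit G k D → C ⊆ D → C ≡ D
  antichain (tC , _) (_ , minD) C⊆D = minD _ tC C⊆D

  -- X ↦ ∣ X ∣ - ∣ V⟨ X ⟩ ∣ is supermodular and C ∩ D is not dense, so C ∪ D has
  -- one edge to spare.
  elimination : ∀ {C D e} → IsKCircuit G k C → IsKCircuit G k D → C ≢ D → e ∈ C → e ∈ D →
                ∃[ F ] (IsKCircuit G k F × F ⊆ (C ∪ D) - e)
  elimination {C} {D} {e} cC@((_ , eqC) , minC) cD@((_ , eqD) , _) C≢D e∈C e∈D =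
    let (ne , le) = dense-minus (x∈p∪q⁺ (inj₁ e∈C)) union-dense in dense⇒circuit ne le
    where
    open ≤-Reasoning
    open +-*-Solver using (solve; _:=_; _:+_)

    ∩-sparse : ∣ C ∩ D ∣ < ∣ V⟨ C ∩ D ⟩ ∣ + k
    ∩-sparse with ∣ C ∩ D ∣ <? ∣ V⟨ C ∩ D ⟩ ∣ + k
    ... | yes lt = lt
    ... | no ≮ with dense⇒circuit (e , x∈p∩q⁺ (e∈C , e∈D)) (≮⇒≥ ≮)
    ...   | F , (tF , _) , F⊆ with refl ← minC F tF (p∩q⊆p C D ∘ F⊆) =
      contradiction (antichain cC cD (p∩q⊆q C D ∘ F⊆)) C≢D

    u v i j c d : ℕ
    u = ∣ C ∪ D ∣
    i = ∣ C ∩ D ∣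
    v = ∣ V⟨ C ∪ D ⟩ ∣
    j = ∣ V⟨ C ∩ D ⟩ ∣
    c = ∣ V⟨ C ⟩ ∣
    d = ∣ V⟨ D ⟩ ∣

    submodular : v + j ≤ c + d
    submodular = ≤-trans
      (+-mono-≤ (p⊆q⇒∣p∣≤∣q∣ (V-∪ C D)) (p⊆q⇒∣p∣≤∣q∣ (V-∩ C D)))
      (≤-reflexive (sym (∣p∣+∣q∣ V⟨ C ⟩ V⟨ D ⟩)))

    union-dense : v + k < u
    union-dense = +-cancelʳ-< i (v + k) u (begin-strict
      v + k + i         <⟨ +-monoʳ-< (v + k) ∩-sparse ⟩
      v + k + (j + k)   ≡⟨ solve 3 (λ v j k → v :+ k :+ (j :+ k) := v :+ j :+ (k :+ k)) refl v j k ⟩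
      v + j + (k + k)   ≤⟨ +-monoˡ-≤ (k + k) submodular ⟩
      c + d + (k + k)   ≡⟨ solve 3 (λ c d k → c :+ d :+ (k :+ k) := c :+ k :+ (d :+ k)) refl c d k ⟩
      c + k + (d + k)   ≡⟨ sym (cong₂ _+_ eqC eqD) ⟩
      ∣ C ∣ + ∣ D ∣     ≡⟨ ∣p∣+∣q∣ C D ⟩
      u + i             ∎)

kCircularMatroid : (k : ℕ) (G : Graph) → Matroid (Graph.#E G)
kCircularMatroid k G = record
  { IsCircuit   = IsKCircuit G k
  ; nonempty    = λ { ((ne , _) , _) → ne }
  ; antichain   = antichain
  ; elimination = elimination
  }
  where open KCircularProof G k

{-# OPTIONS --safe #-}

-- The number of edges minus vertices of a set of edges is largest on the
-- complement of the union T of the tree components.  On that complement it is at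
-- least Δ G + cmp(F(G)), since an acyclic component K has |K| < |V⟨K⟩|.
-- Conversely, adding to V⟨C⟩ one vertex of every tree component, and then
-- repeatedly either an edge leaving the current vertex set together with its new
-- end, or a cycle of a component not reached yet, exhausts all vertices without
-- ever adding fewer edges than vertices.  A single edge spans at least one
-- vertex, hence is independent for k ≥ 1, so only the absence of circuits can
-- make the matroid trivial.

module Submission where

open import Defs
open import Data.Fin.Base using (Fin)
open import Data.Fin.Properties using () renaming (any? to anyFin?; _≟_ to _≟ᶠ_)
open import Data.Fin.Subset
  using (Subset; inside; outside; _∈_; _∉_; _⊆_; _⊂_; _⊃_; _∪_; _∩_; ∁; ⋃; ⊤; ⊥; ∣_∣; Nonempty; ⁅_⁆)
open import Data.Fin.Subset.Induction using (⊃-wellFounded)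
open import Data.Fin.Subset.Properties
import Data.Integer.Base as ℤ
import Data.Integer.Properties as ℤ
open import Data.List.Base as List using (List; []; _∷_; length)
open import Data.List.Membership.Propositional using () renaming (_∈_ to _∈ₗ_)
open import Data.List.Membership.Propositional.Properties
  using (∈-map⁺; ∈-map⁻; ∈-++⁺ˡ; ∈-++⁺ʳ; ∈-filter⁺)
open import Data.List.Relation.Unary.All as All using (All; []; _∷_)
open import Data.List.Relation.Unary.All.Properties using (¬Any⇒All¬; all-filter)
open import Data.List.Relation.Unary.AllPairs using ([]; _∷_)
open import Data.List.Relation.Unary.Any using (here; there; any?)
import Data.List.Relation.Unary.Unique.DecPropositional as DecUnique
open import Data.List.Relation.Unary.Unique.Propositional using (Unique)
open import Data.List.Relation.Unary.Unique.Propositional.Properties using (map⁺; ++⁺; filter⁺)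
open import Data.Nat.Base using (ℕ; zero; suc; _+_; _≤_; _<_; z≤n; s≤s)
open import Data.Nat.Properties
  using (≤-reflexive; ≤-trans; m≤m+n; m≤n+m; +-comm; +-assoc; +-mono-≤; +-monoˡ-≤;
         +-monoʳ-≤; +-cancelʳ-≤; m∸n+n≡m; _≤?_; n<1+n; ≮⇒≥; <⇒≱; module ≤-Reasoning)
open import Data.Nat.Solver using (module +-*-Solver)
open import Data.Product.Base using (_×_; _,_; proj₁; proj₂; ∃-syntax; Σ-syntax)
open import Data.Sum.Base using (_⊎_; inj₁; inj₂; [_,_]; swap)
import Data.Vec.Base as Vec
open import Data.Vec.Properties using (∷-injectiveʳ)
open import Function.Base using (_∘_)
open import Function.Bundles using (_⇔_; mk⇔; Equivalence)
open import Induction.WellFounded using (Acc; acc)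
open import Relation.Binary.PropositionalEquality
  using (_≡_; refl; sym; trans; cong; subst; subst₂)
open import Relation.Nullary using (¬_; Dec; yes; no; contradiction)
open import Relation.Nullary.Decidable using (_×-dec_; ¬?; decidable-stable)

open +-*-Solver using (solve; _:=_; _:+_; con)

-- Finite subsets

module _ {n : ℕ} where

  ⊄⇒⊇ : {p q : Subset n} → p ⊆ q → ¬ (p ⊂ q) → q ⊆ p
  ⊄⇒⊇ {p} p⊆q p⊄q {x} x∈q = decidable-stable (x ∈? p) (λ x∉p → p⊄q (p⊆q , x , x∈q , x∉p))

  ⊂-∪ʳ : (p {q} : Subset n) {x : Fin n} → x ∈ q → x ∉ p → p ⊂ p ∪ q
  ⊂-∪ʳ p {q} x∈q x∉p = p⊆p∪q q , _ , q⊆p∪q p q x∈q , x∉p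

  ∪-lub : {p q r : Subset n} → p ⊆ r → q ⊆ r → p ∪ q ⊆ r
  ∪-lub {p} {q} p⊆r q⊆r = [ p⊆r , q⊆r ] ∘ x∈p∪q⁻ p q

  ⁅⁆⊆ : {p : Subset n} {x : Fin n} → x ∈ p → ⁅ x ⁆ ⊆ p
  ⁅⁆⊆ x∈p y∈ with refl ← x∈⁅y⁆⇒x≡y _ y∈ = x∈p

  ∈-⋃⁺ : ∀ {ps} {p : Subset n} → p ∈ₗ ps → p ⊆ ⋃ ps
  ∈-⋃⁺ {_ ∷ ps} (here refl) = p⊆p∪q (⋃ ps)
  ∈-⋃⁺ {q ∷ ps} (there p∈)  = q⊆p∪q q (⋃ ps) ∘ ∈-⋃⁺ p∈

  ∈-⋃⁻ : ∀ (ps : List (Subset n)) {x} → x ∈ ⋃ ps → ∃[ p ] (p ∈ₗ ps × x ∈ p)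
  ∈-⋃⁻ []       x∈ = contradiction x∈ ∉⊥
  ∈-⋃⁻ (p ∷ ps) x∈ with x∈p∪q⁻ p (⋃ ps) x∈
  ... | inj₁ x∈p = p , here refl , x∈p
  ... | inj₂ x∈⋃ = let (q , q∈ , x∈q) = ∈-⋃⁻ ps x∈⋃ in q , there q∈ , x∈q

  ∣∁p∣+∣p∣ : (p : Subset n) → ∣ ∁ p ∣ + ∣ p ∣ ≡ n
  ∣∁p∣+∣p∣ p = trans (cong (_+ ∣ p ∣) (∣∁p∣≡n∸∣p∣ p)) (m∸n+n≡m (∣p∣≤n p))

-- The graph and k parametrising KCircularProof are irrelevant to ∣p∣+∣q∣.
∣p∪q∣+∣p∩q∣ : ∀ {n} (p q : Subset n) → ∣ p ∪ q ∣ + ∣ p ∩ q ∣ ≡ ∣ p ∣ + ∣ q ∣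
∣p∪q∣+∣p∩q∣ p q = sym (KCircularProof.∣p∣+∣q∣ emptyGraph 0 p q)
  where
  emptyGraph : Graph
  emptyGraph = record { #V = 0 ; #E = 0 ; ends = λ () ; noIsolated = λ () }

module _ {n : ℕ} where

  ∣p∪q∣≤ : (p q : Subset n) → ∣ p ∪ q ∣ ≤ ∣ p ∣ + ∣ q ∣
  ∣p∪q∣≤ p q = ≤-trans (m≤m+n _ _) (≤-reflexive (∣p∪q∣+∣p∩q∣ p q))

  ∣p∪q∣-disjoint : (p q : Subset n) → (∀ {x} → x ∈ p → x ∉ q) → ∣ p ∪ q ∣ ≡ ∣ p ∣ + ∣ q ∣
  ∣p∪q∣-disjoint p q p#q = trans (sym eq) (∣p∪q∣+∣p∩q∣ p q)
    where
    p∩q≡⊥ : p ∩ q ≡ ⊥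
    p∩q≡⊥ = Empty-unique (λ (x , x∈) → let (x∈p , x∈q) = x∈p∩q⁻ p q x∈ in p#q x∈p x∈q)
    eq : ∣ p ∪ q ∣ + ∣ p ∩ q ∣ ≡ ∣ p ∪ q ∣
    eq = trans (cong (∣ p ∪ q ∣ +_) (trans (cong ∣_∣ p∩q≡⊥) (∣⊥∣≡0 n))) (+-comm _ 0)

  ∣⁅x⁆∪p∣≤ : ∀ x (p : Subset n) → ∣ ⁅ x ⁆ ∪ p ∣ ≤ suc ∣ p ∣
  ∣⁅x⁆∪p∣≤ x p = ≤-trans (∣p∪q∣≤ ⁅ x ⁆ p) (≤-reflexive (cong (_+ ∣ p ∣) (∣⁅x⁆∣≡1 x)))

  fromList : List (Fin n) → Subset n
  fromList = ⋃ ∘ List.map ⁅_⁆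

  ∈-fromList⁺ : ∀ {xs x} → x ∈ₗ xs → x ∈ fromList xs
  ∈-fromList⁺ {x = x} x∈ = ∈-⋃⁺ (∈-map⁺ ⁅_⁆ x∈) (x∈⁅x⁆ x)

  ∈-fromList⁻ : ∀ xs {x} → x ∈ fromList xs → x ∈ₗ xs
  ∈-fromList⁻ xs x∈ with ∈-⋃⁻ (List.map ⁅_⁆ xs) x∈
  ... | p , p∈ , x∈p with ∈-map⁻ ⁅_⁆ p∈
  ...   | y , y∈ , refl with refl ← x∈⁅y⁆⇒x≡y y x∈p = y∈

  ∣fromList∣≤ : ∀ xs → ∣ fromList xs ∣ ≤ length xs
  ∣fromList∣≤ []       = ≤-reflexive (∣⊥∣≡0 n)
  ∣fromList∣≤ (x ∷ xs) = ≤-trans (∣⁅x⁆∪p∣≤ x (fromList xs)) (s≤s (∣fromList∣≤ xs))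

  ∣fromList∣-unique : ∀ {xs} → Unique xs → ∣ fromList xs ∣ ≡ length xs
  ∣fromList∣-unique []                     = ∣⊥∣≡0 n
  ∣fromList∣-unique {x ∷ xs} (x∉xs ∷ uniq) = trans
    (∣p∪q∣-disjoint ⁅ x ⁆ (fromList xs) (λ y∈ y∈xs →
      All.lookup x∉xs (∈-fromList⁻ xs y∈xs) (sym (x∈⁅y⁆⇒x≡y x y∈))))
    (trans (cong (_+ ∣ fromList xs ∣) (∣⁅x⁆∣≡1 x)) (cong suc (∣fromList∣-unique uniq)))

-- Enumeration of all subsets

∈-subsets : ∀ {n} (p : Subset n) → p ∈ₗ subsets n
∈-subsets Vec.[]              = here refl
∈-subsets (outside Vec.∷ p)   = ∈-++⁺ˡ (∈-map⁺ (outside Vec.∷_) (∈-subsets p))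
∈-subsets {suc n} (inside Vec.∷ p) =
  ∈-++⁺ʳ (List.map (outside Vec.∷_) (subsets n)) (∈-map⁺ (inside Vec.∷_) (∈-subsets p))

-- `cmpF` is the length of a filtered list, so it counts tree components only if no subset is listed
-- twice.
subsets-unique : ∀ n → Unique (subsets n)
subsets-unique zero    = [] ∷ []
subsets-unique (suc n) = ++⁺
  (map⁺ ∷-injectiveʳ (subsets-unique n)) (map⁺ ∷-injectiveʳ (subsets-unique n))
  (λ (p∈ , q∈) → heads-differ (∈-map⁻ (outside Vec.∷_) p∈) (∈-map⁻ (inside Vec.∷_) q∈))
  where
  heads-differ : ∀ {p} → (∃[ q ] (q ∈ₗ subsets n × p ≡ outside Vec.∷ q)) →
                 ¬ (∃[ q ] (q ∈ₗ subsets n × p ≡ inside Vec.∷ q))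
  heads-differ (_ , _ , refl) (_ , _ , ())

module _ (G : Graph) where
  open Graph G
  -- The imported facts do not mention `k`; `0` is a placeholder.
  open KCircularProof G 0 using (∈V⁺; ∈V⁻; V-mono; V-∪; nonempty⇒∣p∣>0)

  -- Walks

  joins⇒incident : ∀ {e u v} → Joins e u v → Incident e u
  joins⇒incident (inj₁ eq) = inj₁ (cong proj₁ eq)
  joins⇒incident (inj₂ eq) = inj₂ (cong proj₂ eq)

  incident⇒joins : ∀ {e u} → Incident e u → ∃[ v ] Joins e u v
  incident⇒joins (inj₁ refl) = _ , inj₁ refl
  incident⇒joins (inj₂ refl) = _ , inj₂ refl

  joins-incident : ∀ {e u v x} → Joins e u v → Incident e x → x ≡ u ⊎ x ≡ v
  joins-incident (inj₁ refl) (inj₁ refl) = inj₁ refl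
  joins-incident (inj₁ refl) (inj₂ refl) = inj₂ refl
  joins-incident (inj₂ refl) (inj₁ refl) = inj₂ refl
  joins-incident (inj₂ refl) (inj₂ refl) = inj₁ refl

  mono-walk : ∀ {X Y} → X ⊆ Y → ∀ {u v} → Walk G X u v → Walk G Y u v
  mono-walk X⊆Y nil              = nil
  mono-walk X⊆Y (step e e∈X j w) = step e (X⊆Y e∈X) j (mono-walk X⊆Y w)

  sources-mono : ∀ {X Y} (X⊆Y : X ⊆ Y) {u v} (w : Walk G X u v) →
                 sources G (mono-walk X⊆Y w) ≡ sources G w
  sources-mono X⊆Y nil            = refl
  sources-mono X⊆Y (step _ _ _ w) = cong (_ ∷_) (sources-mono X⊆Y w)

  edges-mono : ∀ {X Y} (X⊆Y : X ⊆ Y) {u v} (w : Walk G X u v) →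
               edges G (mono-walk X⊆Y w) ≡ edges G w
  edges-mono X⊆Y nil            = refl
  edges-mono X⊆Y (step _ _ _ w) = cong (_ ∷_) (edges-mono X⊆Y w)

  infixr 5 _++ʷ_
  _++ʷ_ : ∀ {X u v w} → Walk G X u v → Walk G X v w → Walk G X u w
  nil            ++ʷ q = q
  step e e∈X j p ++ʷ q = step e e∈X j (p ++ʷ q)

  walk-closed : ∀ {X} {P : Vertex → Set} → (∀ {e u v} → e ∈ X → Joins e u v → P u → P v) →
                ∀ {u v} → Walk G X u v → P u → P v
  walk-closed closed nil              Pu = Pu
  walk-closed closed (step e e∈X j w) Pu = walk-closed closed w (closed e∈X j Pu)

  edges⊆ : ∀ {X u v e} (w : Walk G X u v) → e ∈ₗ edges G w → e ∈ X
  edges⊆ (step _ e∈X _ _) (here refl) = e∈X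
  edges⊆ (step _ _ _ w)   (there e∈)  = edges⊆ w e∈

  -- The list `v ∷ sources G w` holds all vertices of the walk: `sources` omits the end, which for
  -- `nil` is also the start.
  start∈sources : ∀ {X u v} (w : Walk G X u v) → u ∈ₗ v ∷ sources G w
  start∈sources nil            = here refl
  start∈sources (step _ _ _ _) = there (here refl)

  edges-incident : ∀ {X u v e x} (w : Walk G X u v) → e ∈ₗ edges G w → Incident e x →
                   x ∈ₗ v ∷ sources G w
  edges-incident (step _ _ j w) (here refl) i with joins-incident j i
  ... | inj₁ refl = there (here refl)
  ... | inj₂ refl with start∈sources w
  ...   | here refl = here refl
  ...   | there x∈  = there (there x∈)
  edges-incident (step _ _ _ w) (there e∈) i with edges-incident w e∈ i
  ... | here refl = here refl
  ... | there x∈  = there (there x∈)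

  -- The end comes first so that the vertices of the rest of a walk are obtained by
  -- dropping an element.
  IsPath : ∀ {X u v} → Walk G X u v → Set
  IsPath {v = v} w = Unique (v ∷ sources G w)

  path-from : ∀ {X u v x} (w : Walk G X u v) → IsPath w → x ∈ₗ sources G w →
              Σ[ p ∈ Walk G X x v ] IsPath p
  path-from w@(step _ _ _ _) uniq                      (here refl) = w , uniq
  path-from (step _ _ _ w)   ((_ ∷ v∉) ∷ _ ∷ uniq)   (there x∈)  = path-from w (v∉ ∷ uniq) x∈

  -- If the new start already lies on the path found for the rest, that path is cut there; if it is
  -- the end `v`, nothing remains.
  path : ∀ {X u v} → Walk G X u v → Σ[ p ∈ Walk G X u v ] IsPath p
  path nil = nil , [] ∷ []
  path {v = v} (step {u = u} e e∈X j w) with path w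
  ... | p , uniq@(v∉ ∷ uniq′) with any? (u ≟ᶠ_) (v ∷ sources G p)
  ...   | yes (here refl) = nil , [] ∷ []
  ...   | yes (there u∈)  = path-from p uniq u∈
  ...   | no u∉           = step e e∈X j p ,
    ((λ { refl → u∉ (here refl) }) ∷ v∉) ∷ ¬Any⇒All¬ _ (u∉ ∘ there) ∷ uniq′

  -- A second occurrence of the first edge would bring the first vertex back among the later ones.
  path-edges-unique : ∀ {X u v} (w : Walk G X u v) → IsPath w → Unique (edges G w)
  path-edges-unique nil _ = []
  path-edges-unique (step e _ j w) ((v≢u ∷ v∉) ∷ u∉ ∷ uniq) =
    All.tabulate (λ { e∈ refl → e∉ e∈ }) ∷ path-edges-unique w (v∉ ∷ uniq)
    where
    e∉ : ¬ (e ∈ₗ edges G w)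
    e∉ e∈ with edges-incident w e∈ (joins⇒incident j)
    ... | here u≡v = v≢u (sym u≡v)
    ... | there u∈ = All.lookup u∉ u∈ refl

  -- The edge `e` closes up a path from `v` to `u` inside `Y`, and its absence from `Y` keeps the
  -- edges distinct. `IsPath` of this path is exactly distinctness of the sources of the closed
  -- walk.
  chord⇒cyclic : ∀ {K Y e u v} → Y ⊆ K → e ∈ K → e ∉ Y → Joins e u v → Walk G Y v u →
                 ¬ Acyclic G K
  chord⇒cyclic {K} {Y} {e} {u} Y⊆K e∈K e∉Y j w acyclic with path w
  ... | p , uniq = acyclic u (step e e∈K j (mono-walk Y⊆K p)) (s≤s z≤n ,
    subst (Unique ∘ (u ∷_)) (sym (sources-mono Y⊆K p)) uniq ,
    subst (Unique ∘ (e ∷_)) (sym (edges-mono Y⊆K p))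
      (All.tabulate (λ { e∈ refl → e∉Y (edges⊆ p e∈) }) ∷ path-edges-unique p uniq))

  acyclic⇒no-loop : ∀ {K e u} → Acyclic G K → e ∈ K → ¬ Joins e u u
  acyclic⇒no-loop acyclic e∈K j =
    acyclic _ (step _ e∈K j nil) (s≤s z≤n , [] ∷ [] , [] ∷ [])

  -- `Acyclic` is a negative statement, so the witness comes from a search, decidable because walks
  -- with distinct sources have bounded length.
  cyclic⇒cycle : ∀ {K} → ¬ Acyclic G K → ∃[ v ] Σ[ w ∈ Walk G K v v ] IsCycle G w
  cyclic⇒cycle {K} cyclic with anyFin? cycle?
    where
    open DecUnique (_≟ᶠ_ {#E}) using (unique?)
    cycle? : ∀ v → Dec (Σ[ w ∈ Walk G K v v ]
      (Unique (sources G w) × 1 ≤ length (edges G w) × Unique (edges G w)))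
    cycle? v = uniqueWalk? G K v v (λ _ es → (1 ≤? length es) ×-dec unique? es)
  ... | yes (v , w , s , l , e) = v , w , l , s , e
  ... | no ¬∃ = contradiction (λ v w (l , s , e) → ¬∃ (v , w , s , l , e)) cyclic

  -- A cycle has as many distinct edges as sources, and the sources are all its vertices.
  cycle-dense : ∀ {K} → ¬ Acyclic G K →
                ∃[ C ] (C ⊆ K × Nonempty C × ∣ V⟨ C ⟩ ∣ ≤ ∣ C ∣)
  cycle-dense cyclic with cyclic⇒cycle cyclic
  ... | v , w@(step e _ _ w′) , _ , s , uniq =
    C , edges⊆ w ∘ ∈-fromList⁻ (edges G w) , (e , ∈-fromList⁺ {xs = edges G w} (here refl)) , (begin
      ∣ V⟨ C ⟩ ∣                   ≤⟨ p⊆q⇒∣p∣≤∣q∣ V⊆ ⟩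
      ∣ fromList (sources G w) ∣   ≤⟨ ∣fromList∣≤ (sources G w) ⟩
      length (sources G w)         ≡⟨ length-edges G w ⟨
      length (edges G w)           ≡⟨ ∣fromList∣-unique uniq ⟨
      ∣ C ∣                        ∎)
    where
    open ≤-Reasoning
    C : Subset #E
    C = fromList (edges G w)
    V⊆ : V⟨ C ⟩ ⊆ fromList (sources G w)
    V⊆ x∈ with ∈V⁻ x∈
    ... | f , f∈ , i with edges-incident w (∈-fromList⁻ (edges G w) f∈) i
    -- The end of a closed walk is its start, hence a source.
    ...   | here refl = ∈-fromList⁺ {xs = sources G w} (here refl)
    ...   | there x∈′ = ∈-fromList⁺ x∈′

  -- Components

  connected-⁅⁆ : ∀ e → Connected G ⁅ e ⁆
  connected-⁅⁆ e u v u∈ v∈ with ∈V⁻ u∈ | ∈V⁻ v∈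
  ... | f , f∈ , i | g , g∈ , i′ with refl ← x∈⁅y⁆⇒x≡y e f∈ | refl ← x∈⁅y⁆⇒x≡y e g∈
      with (u′ , j) ← incident⇒joins i with joins-incident j i′
  ...   | inj₁ refl = nil
  ...   | inj₂ refl = step e (x∈⁅x⁆ e) j nil

  connected-∪ : ∀ {X Y x} → Connected G X → Connected G Y → x ∈ V⟨ X ⟩ → x ∈ V⟨ Y ⟩ →
                Connected G (X ∪ Y)
  connected-∪ {X} {Y} {x} cX cY x∈X x∈Y u v u∈ v∈ = to-x ++ʷ from-x
    where
    to-x : Walk G (X ∪ Y) u x
    to-x with x∈p∪q⁻ V⟨ X ⟩ V⟨ Y ⟩ (V-∪ X Y u∈)
    ... | inj₁ u∈X = mono-walk (p⊆p∪q Y) (cX u x u∈X x∈X)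
    ... | inj₂ u∈Y = mono-walk (q⊆p∪q X Y) (cY u x u∈Y x∈Y)
    from-x : Walk G (X ∪ Y) x v
    from-x with x∈p∪q⁻ V⟨ X ⟩ V⟨ Y ⟩ (V-∪ X Y v∈)
    ... | inj₁ v∈X = mono-walk (p⊆p∪q Y) (cX x v x∈X v∈X)
    ... | inj₂ v∈Y = mono-walk (q⊆p∪q X Y) (cY x v x∈Y v∈Y)

  -- Adjoining an edge at a vertex of `K` preserves connectedness, so maximality forces the edge to
  -- be in `K` already.
  component-closed : ∀ {K e v} → IsComponent G K → v ∈ V⟨ K ⟩ → Incident e v → e ∈ K
  component-closed {K} {e} (_ , connected , maximal) v∈ i =
    subst (e ∈_) (maximal (K ∪ ⁅ e ⁆) (p⊆p∪q ⁅ e ⁆)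
                   (connected-∪ connected (connected-⁅⁆ e) v∈ (∈V⁺ (x∈⁅x⁆ e) i)))
      (q⊆p∪q K ⁅ e ⁆ (x∈⁅x⁆ e))

  -- A shared vertex makes the union connected, so by maximality both components equal it.
  components-meet⇒≡ : ∀ {K L v} → IsComponent G K → IsComponent G L →
                      v ∈ V⟨ K ⟩ → v ∈ V⟨ L ⟩ → K ≡ L
  components-meet⇒≡ {K} {L} (_ , cK , maxK) (_ , cL , maxL) v∈K v∈L =
    trans (sym (maxK (K ∪ L) (p⊆p∪q L) c)) (maxL (K ∪ L) (q⊆p∪q K L) c)
    where
    c : Connected G (K ∪ L)
    c = connected-∪ cK cL v∈K v∈L

  component-⊇ : ∀ {X} → Acc _⊃_ X → Nonempty X → Connected G X →
                ∃[ K ] (IsComponent G K × X ⊆ K)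
  component-⊇ {X} (acc rs) ne connected with anySubset? (λ Y → (X ⊂? Y) ×-dec connected? G Y)
  ... | yes (Y , X⊂Y@(X⊆Y , _) , cY) =
    let (K , comp , Y⊆K) = component-⊇ (rs X⊂Y) (proj₁ ne , X⊆Y (proj₂ ne)) cY
    in K , comp , Y⊆K ∘ X⊆Y
  ... | no ¬∃ = X , (ne , connected , λ Y X⊆Y cY →
    ⊆-antisym (⊄⇒⊇ X⊆Y (λ X⊂Y → ¬∃ (Y , X⊂Y , cY))) X⊆Y) , ⊆-refl

  component-∋ : ∀ v → ∃[ K ] (IsComponent G K × v ∈ V⟨ K ⟩)
  component-∋ v =
    let (e , i)           = noIsolated v
        (K , comp , e⊆K)  = component-⊇ (⊃-wellFounded ⁅ e ⁆) (e , x∈⁅x⁆ e) (connected-⁅⁆ e)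
    in K , comp , ∈V⁺ (e⊆K (x∈⁅x⁆ e)) i

  -- The number of edges of a tree

  -- Otherwise `V⟨ Y ⟩` would be closed under the edges of `K`, and connectedness would put an end
  -- of `f` into it, making `f` itself such an edge.
  leaving-edge : ∀ {K Y} → Connected G K → Nonempty Y → Y ⊂ K →
                 ∃[ e ] ((e ∈ K × e ∉ Y) × ∃[ v ] (v ∈ V⟨ Y ⟩ × Incident e v))
  leaving-edge {K} {Y} connected (e , e∈Y) (Y⊆K , f , f∈K , f∉Y)
    with anyFin? (λ e → ((e ∈? K) ×-dec ¬? (e ∈? Y)) ×-dec
           anyFin? (λ v → (v ∈? V⟨ Y ⟩) ×-dec incident? e v))
  ... | yes found = found
  ... | no none   = contradiction (f , (f∈K , f∉Y) , _ , b∈ , inj₁ refl) none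
    where
    closed : ∀ {g u v} → g ∈ K → Joins g u v → u ∈ V⟨ Y ⟩ → v ∈ V⟨ Y ⟩
    closed {g} g∈K j u∈ with g ∈? Y
    ... | yes g∈Y = ∈V⁺ g∈Y (joins⇒incident (swap j))
    ... | no g∉Y  = contradiction (g , (g∈K , g∉Y) , _ , u∈ , joins⇒incident j) none
    b∈ : proj₁ (ends f) ∈ V⟨ Y ⟩
    b∈ = walk-closed closed
      (connected (proj₁ (ends e)) _ (∈V⁺ (Y⊆K e∈Y) (inj₁ refl)) (∈V⁺ f∈K (inj₁ refl)))
      (∈V⁺ e∈Y (inj₁ refl))

  -- Edges are added to `Y` one at a time. Each must bring a new vertex, since with both ends in
  -- `V⟨ Y ⟩` it would close a cycle through the connected `Y`; so the strict inequality persists.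
  grow-tree : ∀ {K Y} → IsTree G K → Acc _⊃_ Y → Y ⊆ K → Nonempty Y → Connected G Y →
              ∣ Y ∣ < ∣ V⟨ Y ⟩ ∣ → ∣ K ∣ < ∣ V⟨ K ⟩ ∣
  grow-tree {K} {Y} tree@(connected , acyclic) (acc rs) Y⊆K ne cY lt with Y ⊂? K
  ... | no Y⊄K = subst (λ X → ∣ X ∣ < ∣ V⟨ X ⟩ ∣) (⊆-antisym Y⊆K (⊄⇒⊇ Y⊆K Y⊄K)) lt
  ... | yes Y⊂K with leaving-edge connected ne Y⊂K
  ...   | e , (e∈K , e∉Y) , u , u∈ , i with incident⇒joins i
  ...     | v , j with v ∈? V⟨ Y ⟩
  ...       | yes v∈ = contradiction acyclic (chord⇒cyclic Y⊆K e∈K e∉Y j (cY v u v∈ u∈))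
  ...       | no v∉  = grow-tree tree (rs (⊂-∪ʳ Y e∈e e∉Y)) (∪-lub Y⊆K (⁅⁆⊆ e∈K))
    (e , q⊆p∪q Y ⁅ e ⁆ e∈e) (connected-∪ cY (connected-⁅⁆ e) u∈ (∈V⁺ e∈e i)) (begin-strict
      ∣ Y ∪ ⁅ e ⁆ ∣      ≤⟨ ∣p∪q∣≤ Y ⁅ e ⁆ ⟩
      ∣ Y ∣ + ∣ ⁅ e ⁆ ∣  ≡⟨ cong (∣ Y ∣ +_) (∣⁅x⁆∣≡1 e) ⟩
      ∣ Y ∣ + 1          ≡⟨ +-comm ∣ Y ∣ 1 ⟩
      suc ∣ Y ∣          ≤⟨ lt ⟩
      ∣ V⟨ Y ⟩ ∣         <⟨ p⊂q⇒∣p∣<∣q∣ (V-mono (p⊆p∪q ⁅ e ⁆) , v ,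
                              ∈V⁺ (q⊆p∪q Y ⁅ e ⁆ e∈e) (joins⇒incident (swap j)) , v∉) ⟩
      ∣ V⟨ Y ∪ ⁅ e ⁆ ⟩ ∣ ∎)
    where
    open ≤-Reasoning
    e∈e : e ∈ ⁅ e ⁆
    e∈e = x∈⁅x⁆ e

  -- The growth starts from one edge, which is no loop and hence has two vertices.
  tree-sparse : ∀ {K} → Nonempty K → IsTree G K → ∣ K ∣ < ∣ V⟨ K ⟩ ∣
  tree-sparse {K} (e , e∈K) tree@(_ , acyclic) =
    grow-tree tree (⊃-wellFounded ⁅ e ⁆) (⁅⁆⊆ e∈K) (e , x∈⁅x⁆ e) (connected-⁅⁆ e) (begin-strict
      ∣ ⁅ e ⁆ ∣        ≡⟨ trans (∣⁅x⁆∣≡1 e) (sym (∣⁅x⁆∣≡1 a)) ⟩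
      ∣ ⁅ a ⁆ ∣        <⟨ p⊂q⇒∣p∣<∣q∣ (⁅⁆⊆ (∈V⁺ (x∈⁅x⁆ e) (inj₁ refl)) , b ,
                            ∈V⁺ (x∈⁅x⁆ e) (inj₂ refl) , b∉) ⟩
      ∣ V⟨ ⁅ e ⁆ ⟩ ∣   ∎)
    where
    open ≤-Reasoning
    a b : Vertex
    a = proj₁ (ends e)
    b = proj₂ (ends e)
    b∉ : b ∉ ⁅ a ⁆
    b∉ b∈ = acyclic⇒no-loop acyclic e∈K (inj₁ (cong (a ,_) (x∈⁅y⁆⇒x≡y a b∈)))

  -- Removing the tree components

  -- Distinct components share no vertex, so the surplus of at least one vertex per tree adds up.
  ⋃-trees-sparse : ∀ {Ks} → Unique Ks → All (IsTreeComponent G) Ks →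
                   ∣ ⋃ Ks ∣ + length Ks ≤ ∣ V⟨ ⋃ Ks ⟩ ∣
  ⋃-trees-sparse {[]} _ _ = ≤-trans (≤-reflexive (trans (+-comm _ 0) (∣⊥∣≡0 #E))) z≤n
  ⋃-trees-sparse {K ∷ Ks} (K∉ ∷ uniq) ((comp , tree) ∷ trees) = begin
    ∣ K ∪ T ∣ + suc l          ≤⟨ +-monoˡ-≤ (suc l) (∣p∪q∣≤ K T) ⟩
    ∣ K ∣ + ∣ T ∣ + suc l      ≡⟨ solve 3 (λ k t l → k :+ t :+ (con 1 :+ l) := con 1 :+ k :+ (t :+ l))
                                     refl (∣ K ∣) (∣ T ∣) l ⟩
    suc ∣ K ∣ + (∣ T ∣ + l)    ≤⟨ +-mono-≤ (tree-sparse (proj₁ comp) tree) (⋃-trees-sparse uniq trees) ⟩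
    ∣ V⟨ K ⟩ ∣ + ∣ V⟨ T ⟩ ∣    ≡⟨ ∣p∪q∣-disjoint V⟨ K ⟩ V⟨ T ⟩ disjoint ⟨
    ∣ V⟨ K ⟩ ∪ V⟨ T ⟩ ∣        ≤⟨ p⊆q⇒∣p∣≤∣q∣ (∪-lub (V-mono (p⊆p∪q T)) (V-mono (q⊆p∪q K T))) ⟩
    ∣ V⟨ K ∪ T ⟩ ∣             ∎
    where
    open ≤-Reasoning
    T : Subset #E
    T = ⋃ Ks
    l : ℕ
    l = length Ks
    disjoint : ∀ {v} → v ∈ V⟨ K ⟩ → v ∉ V⟨ T ⟩
    disjoint v∈K v∈T with ∈V⁻ v∈T
    ... | e , e∈T , i with ∈-⋃⁻ Ks e∈T
    ...   | L , L∈ , e∈L = All.lookup K∉ L∈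
      (components-meet⇒≡ comp (proj₁ (All.lookup trees L∈)) v∈K (∈V⁺ e∈L i))

  treeComponents-sound : All (IsTreeComponent G) (treeComponents G)
  treeComponents-sound = all-filter (isTreeComponent? G) (subsets #E)

  treeComponents-complete : ∀ {K} → IsTreeComponent G K → K ∈ₗ treeComponents G
  treeComponents-complete {K} tree = ∈-filter⁺ (isTreeComponent? G) (∈-subsets K) tree

  treeComponents-unique : Unique (treeComponents G)
  treeComponents-unique = filter⁺ (isTreeComponent? G) (subsets-unique #E)

  F : Subset #E
  F = ⋃ (treeComponents G)

  -- A component contains every edge at its vertices, so no edge outside `F` touches a tree
  -- component.
  V∁F-disjoint : ∀ {v} → v ∈ V⟨ ∁ F ⟩ → v ∉ V⟨ F ⟩
  V∁F-disjoint v∈∁ v∈F with ∈V⁻ v∈∁ | ∈V⁻ v∈F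
  ... | e , e∈∁ , i | f , f∈F , i′ with ∈-⋃⁻ (treeComponents G) f∈F
  ...   | K , K∈ , f∈K = x∈∁p⇒x∉p e∈∁ (∈-⋃⁺ K∈
    (component-closed (proj₁ (All.lookup treeComponents-sound K∈)) (∈V⁺ f∈K i′) i))

  -- Deleting `F` loses at least `cmpF G` more vertices than edges, which pays for the term `cmpF G`
  -- in the bound.
  ∁F-dense : ∀ {k} → #V + k ≤ #E + cmpF G → ∣ V⟨ ∁ F ⟩ ∣ + k ≤ ∣ ∁ F ∣
  ∁F-dense {k} le = +-cancelʳ-≤ f (d + k) ∣ ∁ F ∣ (begin
    d + k + f                    ≡⟨ solve 3 (λ d k f → d :+ k :+ f := d :+ f :+ k) refl d k f ⟩
    d + f + k                    ≡⟨ cong (_+ k) (∣p∪q∣-disjoint V⟨ ∁ F ⟩ V⟨ F ⟩ V∁F-disjoint) ⟨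
    ∣ V⟨ ∁ F ⟩ ∪ V⟨ F ⟩ ∣ + k    ≤⟨ +-monoˡ-≤ k (∣p∣≤n (V⟨ ∁ F ⟩ ∪ V⟨ F ⟩)) ⟩
    #V + k                       ≤⟨ le ⟩
    #E + c                       ≡⟨ cong (_+ c) (∣∁p∣+∣p∣ F) ⟨
    ∣ ∁ F ∣ + ∣ F ∣ + c          ≡⟨ solve 3 (λ x y c → x :+ y :+ c := x :+ (y :+ c)) refl (∣ ∁ F ∣) (∣ F ∣) c ⟩
    ∣ ∁ F ∣ + (∣ F ∣ + c)        ≤⟨ +-monoʳ-≤ ∣ ∁ F ∣ (⋃-trees-sparse treeComponents-unique treeComponents-sound) ⟩
    ∣ ∁ F ∣ + f                  ∎)
    where
    open ≤-Reasoning
    c d f : ℕ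
    c = cmpF G
    d = ∣ V⟨ ∁ F ⟩ ∣
    f = ∣ V⟨ F ⟩ ∣

  -- Exhausting the vertices

  Meets : Subset #V → Subset #E → Set
  Meets U K = ∃[ v ] (v ∈ V⟨ K ⟩ × v ∈ U)

  meets-mono : ∀ {U W K} → U ⊆ W → Meets U K → Meets W K
  meets-mono U⊆W (v , v∈K , v∈U) = v , v∈K , U⊆W v∈U

  -- One end of some edge is picked per member; picks may coincide, hence only `≤`.
  transversal : ∀ {Ks} → All Nonempty Ks → ∃[ W ] (∣ W ∣ ≤ length Ks × All (Meets W) Ks)
  transversal [] = ⊥ , ≤-reflexive (∣⊥∣≡0 #V) , []
  transversal (_∷_ {x = K} (e , e∈K) nes) with transversal nes
  ... | W , le , meets = ⁅ v ⁆ ∪ W , ≤-trans (∣⁅x⁆∪p∣≤ v W) (s≤s le) ,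
    (v , ∈V⁺ e∈K (inj₁ refl) , p⊆p∪q W (x∈⁅x⁆ v)) ∷
    All.map (λ {L} → meets-mono {K = L} (q⊆p∪q ⁅ v ⁆ W)) meets
    where
    v : Vertex
    v = proj₁ (ends e)

  -- Enlarging the pair does not increase `∣ U ∣ - ∣ Y ∣`, since all edges of `Z` are new and at
  -- least as many as the vertices of `W`. So the lower bound passes back to the smaller pair.
  exhaust-step : ∀ {U W : Subset #V} {Y Z : Subset #E} → (∀ {e} → e ∈ Y → e ∉ Z) → ∣ W ∣ ≤ ∣ Z ∣ →
    #V + ∣ Y ∪ Z ∣ ≤ #E + ∣ U ∪ W ∣ → #V + ∣ Y ∣ ≤ #E + ∣ U ∣
  exhaust-step {U} {W} {Y} {Z} Y#Z W≤Z le = +-cancelʳ-≤ z (#V + ∣ Y ∣) (#E + ∣ U ∣) (begin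
    #V + ∣ Y ∣ + z         ≡⟨ +-assoc #V ∣ Y ∣ z ⟩
    #V + (∣ Y ∣ + z)       ≡⟨ cong (#V +_) (∣p∪q∣-disjoint Y Z Y#Z) ⟨
    #V + ∣ Y ∪ Z ∣         ≤⟨ le ⟩
    #E + ∣ U ∪ W ∣         ≤⟨ +-monoʳ-≤ #E (∣p∪q∣≤ U W) ⟩
    #E + (∣ U ∣ + ∣ W ∣)   ≤⟨ +-monoʳ-≤ #E (+-monoʳ-≤ ∣ U ∣ W≤Z) ⟩
    #E + (∣ U ∣ + z)       ≡⟨ +-assoc #E ∣ U ∣ z ⟨
    #E + ∣ U ∣ + z         ∎)
    where
    open ≤-Reasoning
    z : ℕ
    z = ∣ Z ∣

  -- Read as `∣ U ∣ - ∣ Y ∣ ≥ #V - #E`, the claim is clear once `U` holds all vertices. Until then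
  -- `U` grows, and `V⟨ Y ⟩ ⊆ U` guarantees that the added edges are not yet in `Y`.
  exhaust : ∀ {U Y} → Acc _⊃_ U → V⟨ Y ⟩ ⊆ U → (∀ {K} → IsTreeComponent G K → Meets U K) →
            #V + ∣ Y ∣ ≤ #E + ∣ U ∣
  exhaust {U} {Y} (acc rs) VY⊆U meets
    with anyFin? (λ v → ¬? (v ∈? U))
       | anyFin? (λ e → anyFin? (λ u → anyFin? (λ v → (u ∈? U) ×-dec ¬? (v ∈? U) ×-dec joins? e u v)))
  ... | no U-full | _ =
    subst₂ _≤_ (+-comm ∣ Y ∣ #V) (cong (#E +_) (sym ∣U∣≡#V)) (+-monoˡ-≤ #V (∣p∣≤n Y))
    where
    ∣U∣≡#V : ∣ U ∣ ≡ #V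
    ∣U∣≡#V = trans (cong ∣_∣ (⊆-antisym ⊆⊤
      (λ {v} _ → decidable-stable (v ∈? U) (λ v∉ → U-full (v , v∉))))) (∣⊤∣≡n #V)
  ... | yes _ | yes (e , u , v , u∈ , v∉ , j) =
    exhaust-step {U} {⁅ v ⁆} {Y} {⁅ e ⁆} Y#e
      (≤-reflexive (trans (∣⁅x⁆∣≡1 v) (sym (∣⁅x⁆∣≡1 e))))
      (exhaust (rs (⊂-∪ʳ U (x∈⁅x⁆ v) v∉))
        (∪-lub (p⊆p∪q ⁅ v ⁆ ∘ VY⊆U) Ve⊆ ∘ V-∪ Y ⁅ e ⁆)
        (λ {K} tree → meets-mono {K = K} (p⊆p∪q ⁅ v ⁆) (meets tree)))
    where
    Y#e : ∀ {f} → f ∈ Y → f ∉ ⁅ e ⁆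
    Y#e f∈Y f∈ with refl ← x∈⁅y⁆⇒x≡y e f∈ = v∉ (VY⊆U (∈V⁺ f∈Y (joins⇒incident (swap j))))
    Ve⊆ : V⟨ ⁅ e ⁆ ⟩ ⊆ U ∪ ⁅ v ⁆
    Ve⊆ x∈ with ∈V⁻ x∈
    ... | f , f∈ , i with refl ← x∈⁅y⁆⇒x≡y e f∈ with joins-incident j i
    ...   | inj₁ refl = p⊆p∪q ⁅ v ⁆ u∈
    ...   | inj₂ refl = q⊆p∪q U ⁅ v ⁆ (x∈⁅x⁆ v)
  -- No edge leaves `U`, so the component of the missed vertex `v` avoids `U` entirely. Tree
  -- components all meet `U`, so this one contains a cycle.
  ... | yes (v , v∉) | no none with component-∋ v
  ...   | K , comp@(_ , connected , _) , v∈K = with-cycle (cycle-dense cyclic)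
    where
    K#U : ∀ {x} → x ∈ V⟨ K ⟩ → x ∉ U
    K#U x∈K x∈U = v∉ (walk-closed
      (λ {e} {u} {w} _ j u∈ → decidable-stable (w ∈? U) (λ w∉ → none (e , u , w , u∈ , w∉ , j)))
      (connected _ v x∈K v∈K) x∈U)
    cyclic : ¬ Acyclic G K
    cyclic acyclic = let (x , x∈K , x∈U) = meets (comp , connected , acyclic) in K#U x∈K x∈U
    with-cycle : ∃[ C ] (C ⊆ K × Nonempty C × ∣ V⟨ C ⟩ ∣ ≤ ∣ C ∣) → #V + ∣ Y ∣ ≤ #E + ∣ U ∣
    with-cycle (C , C⊆K , (e , e∈C) , dense) =
      exhaust-step {U} {V⟨ C ⟩} {Y} {C}
        (λ f∈Y f∈C → K#U (∈V⁺ (C⊆K f∈C) (inj₁ refl)) (VY⊆U (∈V⁺ f∈Y (inj₁ refl))))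
        dense
        (exhaust (rs (⊂-∪ʳ U (∈V⁺ e∈C (inj₁ refl)) (K#U (∈V⁺ (C⊆K e∈C) (inj₁ refl)))))
          (∪-lub (p⊆p∪q V⟨ C ⟩ ∘ VY⊆U) (q⊆p∪q U V⟨ C ⟩) ∘ V-∪ Y C)
          (λ {K} tree → meets-mono {K = K} (p⊆p∪q V⟨ C ⟩) (meets tree)))

  -- Exhaustion starts from `V⟨ X ⟩` with a vertex of every tree component added, at a cost of at
  -- most `cmpF G` vertices.
  excess-≤ : ∀ X → #V + ∣ X ∣ ≤ #E + cmpF G + ∣ V⟨ X ⟩ ∣
  excess-≤ X with transversal (All.map (λ { ((ne , _) , _) → ne }) treeComponents-sound)
  ... | W , ∣W∣≤ , meets = begin
    #V + ∣ X ∣                     ≤⟨ exhaust (⊃-wellFounded (V⟨ X ⟩ ∪ W)) (p⊆p∪q W)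
                                        (λ {K} tree → meets-mono {K = K} (q⊆p∪q V⟨ X ⟩ W)
                                          (All.lookup meets (treeComponents-complete tree))) ⟩
    #E + ∣ V⟨ X ⟩ ∪ W ∣            ≤⟨ +-monoʳ-≤ #E (∣p∪q∣≤ V⟨ X ⟩ W) ⟩
    #E + (∣ V⟨ X ⟩ ∣ + ∣ W ∣)      ≤⟨ +-monoʳ-≤ #E (+-monoʳ-≤ ∣ V⟨ X ⟩ ∣ ∣W∣≤) ⟩
    #E + (∣ V⟨ X ⟩ ∣ + cmpF G)     ≡⟨ cong (#E +_) (+-comm ∣ V⟨ X ⟩ ∣ (cmpF G)) ⟩
    #E + (cmpF G + ∣ V⟨ X ⟩ ∣)     ≡⟨ +-assoc #E (cmpF G) ∣ V⟨ X ⟩ ∣ ⟨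
    #E + cmpF G + ∣ V⟨ X ⟩ ∣       ∎
    where open ≤-Reasoning

-- Integer and natural forms of the bound

≤-⊖+⇔ : ∀ k m n c → (ℤ.+ k ℤ.≤ (m ℤ.⊖ n) ℤ.+ ℤ.+ c) ⇔ (n + k ≤ m + c)
≤-⊖+⇔ k m n c = mk⇔
  (λ le → ≮⇒≥ (λ lt → ℤ.≤⇒≯ (subst₂ ℤ._≤_ lhs rhs le) (ℤ.⊖-monoˡ-< n lt)))
  (λ le → subst₂ ℤ._≤_ (sym lhs) (sym rhs) (ℤ.⊖-monoˡ-≤ n le))
  where
  -- Both sides become differences with the same subtrahend `n`, so that monotonicity of `_⊖ n`
  -- applies.
  lhs : ℤ.+ k ≡ (n + k) ℤ.⊖ n
  lhs = trans (sym (ℤ.+-cancelˡ-⊖ n k 0)) (cong ((n + k) ℤ.⊖_) (+-comm n 0))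
  rhs : (m ℤ.⊖ n) ℤ.+ ℤ.+ c ≡ (m + c) ℤ.⊖ n
  rhs = ℤ.distribˡ-⊖-+-pos c m n

-- Circuits, the bound and non-triviality for fixed `k`

module _ (G : Graph) (k : ℕ) (1≤k : 1 ≤ k) where
  open Graph G
  open KCircularProof G k using (∣V∣>0; ∣p∣>0⇒nonempty; dense⇒circuit)
  open Matroid (kCircularMatroid k G)

  -- The edges of a circuit outnumber its vertices by exactly `k`, and `excess-≤` caps this excess.
  circuit⇒bound : (∃[ C ] IsCircuit C) → #V + k ≤ #E + cmpF G
  circuit⇒bound (C , (_ , tight) , _) = +-cancelʳ-≤ v (#V + k) (#E + cmpF G) (begin
    #V + k + v          ≡⟨ solve 3 (λ n k v → n :+ k :+ v := n :+ (v :+ k)) refl #V k v ⟩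
    #V + (v + k)        ≡⟨ cong (#V +_) tight ⟨
    #V + ∣ C ∣          ≤⟨ excess-≤ G C ⟩
    #E + cmpF G + v     ∎)
    where
    open ≤-Reasoning
    v : ℕ
    v = ∣ V⟨ C ⟩ ∣

  bound⇒circuit : #V + k ≤ #E + cmpF G → ∃[ C ] IsCircuit C
  bound⇒circuit le =
    let dense       = ∁F-dense G le
        -- As `k` is positive, density of `∁ F` already forces it to have an edge.
        nonempty-∁F = ∣p∣>0⇒nonempty _ (≤-trans 1≤k (≤-trans (m≤n+m k _) dense))
        (C , c , _) = dense⇒circuit nonempty-∁F dense
    in C , c

  -- A circuit spans at least one vertex, so it has at least `1 + k ≥ 2` edges.
  ⁅⁆-independent : ∀ e → Independent ⁅ e ⁆
  ⁅⁆-independent e C ((ne , tight) , _) C⊆e = <⇒≱ (n<1+n 1) (begin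
    2                  ≤⟨ +-mono-≤ (∣V∣>0 ne) 1≤k ⟩
    ∣ V⟨ C ⟩ ∣ + k     ≡⟨ tight ⟨
    ∣ C ∣              ≤⟨ p⊆q⇒∣p∣≤∣q∣ C⊆e ⟩
    ∣ ⁅ e ⁆ ∣          ≡⟨ ∣⁅x⁆∣≡1 e ⟩
    1                  ∎)
    where open ≤-Reasoning

  circuit⇒nonTrivial : (∃[ C ] IsCircuit C) → NonTrivial
  circuit⇒nonTrivial (C , c) (inj₁ (independent , _)) = independent C c ⊆⊤
  -- If `⊤` is a cobase, the empty set is a base, yet an edge of `C` gives an independent singleton
  -- above it.
  circuit⇒nonTrivial (C , c) (inj₂ (_ , maximal)) = x∈∁p⇒x∉p e∈∁⊤ ∈⊤
    where
    e : Edge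
    e = proj₁ (nonempty c)
    e∈∁⊤ : e ∈ ∁ ⊤
    e∈∁⊤ = subst (e ∈_) (sym (maximal ⁅ e ⁆ (⁅⁆-independent e)
      (λ x∈ → contradiction ∈⊤ (x∈∁p⇒x∉p x∈)))) (x∈⁅x⁆ e)

  -- Without circuits every set is independent, so `⊤` is a base. Decidability of the circuit search
  -- removes the double negation.
  nonTrivial⇒circuit : NonTrivial → ∃[ C ] IsCircuit C
  nonTrivial⇒circuit nonTrivial = decidable-stable (anySubset? (isKCircuit? G k))
    (λ none → nonTrivial (inj₁ ((λ C c _ → none (C , c)) , λ _ _ ⊤⊆I → ⊆-antisym ⊤⊆I ⊆⊤)))

mainTheorem10 : (G : Graph) (k : ℕ) → 1 ≤ k →
    let open Matroid (kCircularMatroid k G) in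
    ((∃[ C ] IsCircuit C) ⇔ (ℤ.+ k ℤ.≤ Graph.Δ G ℤ.+ (ℤ.+ cmpF G)))
    × ((ℤ.+ k ℤ.≤ Graph.Δ G ℤ.+ (ℤ.+ cmpF G)) ⇔ NonTrivial)
mainTheorem10 G k 1≤k =
  mk⇔ (from ∘ circuit⇒bound G k 1≤k) (bound⇒circuit G k 1≤k ∘ to) ,
  mk⇔ (circuit⇒nonTrivial G k 1≤k ∘ bound⇒circuit G k 1≤k ∘ to)
      (from ∘ circuit⇒bound G k 1≤k ∘ nonTrivial⇒circuit G k 1≤k)
  where
  open Equivalence (≤-⊖+⇔ k (Graph.#E G) (Graph.#V G) (cmpF G)) using (to; from)
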